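{- Let $X$ be a finite nonempty alphabet and $\mathcal{L}\subseteq 2^{X^*}$ a nontrivial, WP-recursive language family closed under finite unions, finite intersections and complementation. Let $(C,\mathbf{A})$ be a conditional classification problem with $\mathbf{A}=(A_1,\dots,A_k)$, $C$ recursive, and for each $1\le i\le k$: $A_i$ recursive and $A_i\notin\mathit{cclass}_1(C,\mathcal{L})$. Then there exists $\mathbf{B}=(B_1,\dots,B_k)$ with $\mathbf{B}\le\mathbf{A}$, $\mathbf{B}\in\mathit{ccore}_k(C,\mathcal{L})$, and each $B_i$ recursive.
   Context: $\mathcal{L}$ is nontrivial if $\emptyset,X^*\in\mathcal{L}$ and for all $Q\in\mathcal{L}$ and finite $E\subseteq X^*$ both $Q\cup E\in\mathcal{L}$ and $Q\setminus E\in\mathcal{L}$. $\mathcal{L}$ is WP-recursive if there is a surjection $e:\mathbb{N}_0\to\mathcal{L}$ such that the predicate "$w\in e(i)$" (for $i\in\mathbb{N}_0$, $w\in X^*$) is decidable uniformly in $i,w$. A classification problem is a vector $(A_1,\dots,A_k)$, $k\ge1$, of pairwise disjoint infinite subsets of $X^*$, of length $k$. A conditional classification problem is a pair $(C,\mathbf{A})$ with $C\subseteq X^*$, $\mathbf{A}$ a classification problem and $C$ disjoint from all components of $\mathbf{A}$. For vectors $\mathbf{B}=(B_1,\dots,B_m)$, $\mathbf{Q}=(Q_1,\dots,Q_k)$, $\mathbf{B}\le\mathbf{Q}$ means $1\le m\le k$ and there is an injective $\sigma:\{1,\dots,m\}\to\{1,\dots,k\}$ with $B_i\subseteq Q_{\sigma(i)}$.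 An $\mathcal{L}$-partition is a vector of pairwise disjoint members of $\mathcal{L}$ whose union is $X^*$. $\mathit{cclass}_k(C,\mathcal{L})$ is the set of classification problems $\mathbf{A}$ of length $k$ such that $(C,\mathbf{A})$ is a conditional classification problem and there is an $\mathcal{L}$-partition $(Q_0,Q_1,\dots,Q_k)$ with $C\subseteq Q_0$ and $\mathbf{A}\le(Q_1,\dots,Q_k)$ (a single set $A$ is identified with $(A)$). $\mathit{ccore}_k(C,\mathcal{L})$ is the set of classification problems $\mathbf{A}$ of length $k$ with $(C,\mathbf{A})$ a conditional classification problem such that every classification problem $\mathbf{A}'\le\mathbf{A}$ (any length $\ge1$) satisfies $\mathbf{A}'\notin\mathit{cclass}_{|\mathbf{A}'|}(C,\mathcal{L})$. -}

module Defs where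

open import Data.Fin.Base using (Fin; toℕ)
open import Data.List.Base using (List; []; _∷_)
import Data.List.Membership.Propositional as List
open import Data.Nat.Base using (ℕ; suc; _+_; _*_; _≤_; _<_)
open import Data.Product.Base using (∃-syntax; Σ-syntax; _×_)
open import Data.Sum.Base using (_⊎_)
open import Data.Vec.Base as Vec using (Vec)
open import Data.Vec.Functional as VecF using (Vector)
open import Data.Vec.Relation.Binary.Pointwise.Inductive using (Pointwise)
open import Function.Bundles using (_↔_; Inverse)
open import Function.Definitions using (Injective)
open import Level using (Level; 0ℓ; _⊔_) renaming (suc to lsuc)
open import Relation.Binary.PropositionalEquality.Core using (_≡_; _≢_)
open import Relation.Nullary.Negation.Core using (¬_)
open import Relation.Unary using (Pred; _∈_; _∉_; _⊆_; _≐_; _⊥_; ∅; U; ∁; _∪_; _∩_; _∖_)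

-- Kleene's schemes for the partial recursive functions on ℕ. In precᶠ the
-- step function receives (t, previous value, parameters).
data PartRec : ℕ → Set where
  zeroᶠ : ∀ {n} → PartRec n
  sucᶠ  : PartRec 1
  projᶠ : ∀ {n} → Fin n → PartRec n
  compᶠ : ∀ {m n} → PartRec m → Vec (PartRec n) m → PartRec n
  precᶠ : ∀ {n} → PartRec n → PartRec (2 + n) → PartRec (suc n)
  minᶠ  : ∀ {n} → PartRec (suc n) → PartRec n

infix 4 _[_]⇓_

-- f [ xs ]⇓ y : f is defined at xs, with value y.
data _[_]⇓_ : ∀ {n} → PartRec n → Vec ℕ n → ℕ → Set where
  ⇓zero : ∀ {n} {xs : Vec ℕ n} → zeroᶠ [ xs ]⇓ 0
  ⇓suc  : ∀ {x} → sucᶠ [ x Vec.∷ Vec.[] ]⇓ suc x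
  ⇓proj : ∀ {n} {xs : Vec ℕ n} {i} → projᶠ i [ xs ]⇓ Vec.lookup xs i
  ⇓comp : ∀ {m n} {f : PartRec m} {gs : Vec (PartRec n) m} {xs ys z} →
          Pointwise (λ g y → g [ xs ]⇓ y) gs ys → f [ ys ]⇓ z →
          compᶠ f gs [ xs ]⇓ z
  ⇓prec-zero : ∀ {n} {f : PartRec n} {g xs y} →
               f [ xs ]⇓ y →
               precᶠ f g [ 0 Vec.∷ xs ]⇓ y
  ⇓prec-suc  : ∀ {n} {f : PartRec n} {g xs t y z} →
               precᶠ f g [ t Vec.∷ xs ]⇓ y → g [ t Vec.∷ y Vec.∷ xs ]⇓ z →
               precᶠ f g [ suc t Vec.∷ xs ]⇓ z
  ⇓min  : ∀ {n} {f : PartRec (suc n)} {xs y} →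
          (∀ z → z < y → ∃[ v ] f [ z Vec.∷ xs ]⇓ suc v) → f [ y Vec.∷ xs ]⇓ 0 →
          minᶠ f [ xs ]⇓ y

-- f computes, at the argument xs, the truth value of P.
DecidesAt : ∀ {n} → PartRec n → Vec ℕ n → Set → Set
DecidesAt f xs P = (P × f [ xs ]⇓ 1) ⊎ (¬ P × f [ xs ]⇓ 0)

Word : Set → Set
Word X = List X

Language : Set → Set₁
Language X = Pred (Word X) 0ℓ

-- Finite sets are those listed exactly by some list; merely being contained
-- in a list is equivalent only classically.
Finite : ∀ {X} → Language X → Set
Finite E = ∃[ ws ] E ≐ (List._∈ ws)

Infinite : ∀ {X} → Language X → Set
Infinite A = ¬ Finite A

module _ {X : Set} {n : ℕ} (enum : X ↔ Fin (suc n)) where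

  -- Bijective base-(n+1) numeration, least significant letter first: a
  -- computable bijection between words and ℕ.
  code : Word X → ℕ
  code []      = 0
  code (a ∷ w) = suc (toℕ (Inverse.to enum a) + suc n * code w)

  Recursive : Language X → Set
  Recursive A = ∃[ f ] ∀ w → DecidesAt f (code w Vec.∷ Vec.[]) (w ∈ A)

  -- The elements of 2^{X*} are languages up to ≐, so surjectivity is up to ≐.
  WPRecursive : ∀ {ℓ} → Pred (Language X) ℓ → Set (lsuc 0ℓ ⊔ ℓ)
  WPRecursive 𝓛 =
    Σ[ e ∈ (ℕ → Language X) ]
      (∀ i → e i ∈ 𝓛) ×
      (∀ Q → Q ∈ 𝓛 → ∃[ i ] e i ≐ Q) ×
      (∃[ f ] ∀ i w → DecidesAt f (i Vec.∷ code w Vec.∷ Vec.[]) (w ∈ e i))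

module _ {X : Set} {ℓ : Level} (𝓛 : Pred (Language X) ℓ) where

  record Nontrivial : Set (lsuc 0ℓ ⊔ ℓ) where
    field
      ∅∈   : ∅ ∈ 𝓛
      U∈   : U ∈ 𝓛
      ∪fin : ∀ {Q E} → Q ∈ 𝓛 → Finite E → (Q ∪ E) ∈ 𝓛
      ∖fin : ∀ {Q E} → Q ∈ 𝓛 → Finite E → (Q ∖ E) ∈ 𝓛

  ClosedUnderUnion : Set (lsuc 0ℓ ⊔ ℓ)
  ClosedUnderUnion = ∀ {P Q} → P ∈ 𝓛 → Q ∈ 𝓛 → (P ∪ Q) ∈ 𝓛

  ClosedUnderIntersection : Set (lsuc 0ℓ ⊔ ℓ)
  ClosedUnderIntersection = ∀ {P Q} → P ∈ 𝓛 → Q ∈ 𝓛 → (P ∩ Q) ∈ 𝓛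

  ClosedUnderComplement : Set (lsuc 0ℓ ⊔ ℓ)
  ClosedUnderComplement = ∀ {Q} → Q ∈ 𝓛 → ∁ Q ∈ 𝓛

PairwiseDisjoint : ∀ {X k} → Vector (Language X) k → Set
PairwiseDisjoint A = ∀ i j → i ≢ j → A i ⊥ A j

record ClassificationProblem {X k} (A : Vector (Language X) k) : Set where
  field
    length≥1 : 1 ≤ k
    disjoint : PairwiseDisjoint A
    infinite : ∀ i → Infinite (A i)

record ConditionalProblem {X k} (C : Language X) (A : Vector (Language X) k) : Set where
  field
    problem  : ClassificationProblem A
    disjoint : ∀ i → C ⊥ A i

infix 4 _≼_

_≼_ : ∀ {X m k} → Vector (Language X) m → Vector (Language X) k → Set
_≼_ {m = m} {k} B Q =
  1 ≤ m × m ≤ k ×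
  (Σ[ σ ∈ (Fin m → Fin k) ] Injective _≡_ _≡_ σ × (∀ i → B i ⊆ Q (σ i)))

⟨_⟩ : ∀ {X} → Language X → Vector (Language X) 1
⟨ A ⟩ = A VecF.∷ VecF.[]

module _ {X : Set} {ℓ : Level} where

  record IsPartition {k} (𝓛 : Pred (Language X) ℓ) (Q : Vector (Language X) k) : Set ℓ where
    field
      members  : ∀ i → Q i ∈ 𝓛
      disjoint : PairwiseDisjoint Q
      covers   : ∀ w → ∃[ i ] w ∈ Q i

  cclass : ∀ k → Language X → Pred (Language X) ℓ → Pred (Vector (Language X) k) (lsuc 0ℓ ⊔ ℓ)
  cclass k C 𝓛 A =
    ConditionalProblem C A ×
    (Σ[ Q ∈ Vector (Language X) (suc k) ] IsPartition 𝓛 Q × C ⊆ VecF.head Q × A ≼ VecF.tail Q)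

  ccore : ∀ k → Language X → Pred (Language X) ℓ → Pred (Vector (Language X) k) (lsuc 0ℓ ⊔ ℓ)
  ccore k C 𝓛 A =
    ConditionalProblem C A ×
    (∀ {m} (A′ : Vector (Language X) m) → ClassificationProblem A′ → A′ ≼ A → A′ ∉ cclass m C 𝓛)

{-# OPTIONS --safe #-}

-- Write e 0, e 1, … for the enumeration of 𝓛 and scan the words w in the order
-- of their codes. Having put s words of A i into B i so far, add w ∈ A i iff
-- every e j with j < s that contains w also meets C in a word preceding w.
--
-- * If e j is disjoint from C, no word of e j is added once j < s, so e j ∩ B i
--   is finite. Hence no infinite subset of B i is separated from C by 𝓛.
-- * If B i were finite, s would stabilise, and all but finitely many words of
--   A i would be covered by those e j, j < s, that are disjoint from C; their
--   union, enlarged by finitely many words of A i, would separate A i from C.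
module Submission where

open import Defs
open import Data.Bool.Base using (if_then_else_)
open import Data.Fin.Base using (Fin; zero; suc; toℕ; fromℕ<)
open import Data.Fin.Properties using (toℕ<n; toℕ-injective; toℕ-fromℕ<)
open import Data.List.Base using (List; []; _∷_; map; upTo; filter)
open import Data.List.Membership.Propositional using () renaming (_∈_ to _∈ˡ_)
open import Data.List.Membership.Propositional.Properties using (∈-map⁺; ∈-upTo⁺; ∈-filter⁺; ∈-filter⁻)
open import Data.List.Relation.Unary.Any using (here; there)
open import Data.Nat.Base using (ℕ; zero; suc; _+_; _*_; _≤_; _<_; _⊔_; z≤n; s≤s)
open import Data.Nat.DivMod using (_/_; _%_; m≡m%n+[m/n]*n; m%n<n; m/n≤m; [m+kn]%n≡m%n; m<n⇒m%n≡m)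
open import Data.Nat.Induction using (<-rec)
open import Data.Nat.Properties
open import Data.Product.Base using (Σ-syntax; ∃-syntax; _×_; _,_; proj₁; proj₂; map₂)
open import Data.Sum.Base using (_⊎_; inj₁; inj₂; [_,_]′)
open import Data.Vec.Base as Vec using (Vec)
open import Data.Vec.Functional using (Vector)
import Data.Vec.Functional as VecF
open import Data.Vec.Relation.Binary.Pointwise.Inductive using (Pointwise; []; _∷_)
open import Function.Base using (_∘_; id)
open import Function.Bundles using (_↔_; Inverse)
open import Level using (Level)
open import Relation.Binary.Definitions using (_Respects_)
open import Relation.Binary.PropositionalEquality using (_≡_; refl; sym; trans; cong; cong₂; subst; module ≡-Reasoning)
open import Relation.Nullary.Decidable using (Dec; yes; no; does; dec-true; dec-false; decidable-stable; ¬¬-excluded-middle)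
open import Relation.Nullary.Negation using (¬_; contradiction)
open import Relation.Unary using (Pred; _∈_; _∉_; _⊆_; _≐_; _⊥_; _∪_; ∁)

-- Closure properties of decidability by programs

oneᶠ : ∀ {n} → PartRec n
oneᶠ = compᶠ sucᶠ (zeroᶠ Vec.∷ Vec.[])

⇓one : ∀ {n} {xs : Vec ℕ n} → oneᶠ [ xs ]⇓ 1
⇓one = ⇓comp (⇓zero ∷ []) ⇓suc

decidesAt⇒dec : ∀ {n f P} {xs : Vec ℕ n} → DecidesAt f xs P → Dec P
decidesAt⇒dec (inj₁ (p , _))  = yes p
decidesAt⇒dec (inj₂ (¬p , _)) = no ¬p

decidesAt-⇔ : ∀ {n f P Q} {xs : Vec ℕ n} → (P → Q) → (Q → P) → DecidesAt f xs P → DecidesAt f xs Q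
decidesAt-⇔ to from (inj₁ (p , f⇓))  = inj₁ (to p , f⇓)
decidesAt-⇔ to from (inj₂ (¬p , f⇓)) = inj₂ (¬p ∘ from , f⇓)

decidesAt-comp : ∀ {m n f P} {gs : Vec (PartRec n) m} {xs ys} →
  Pointwise (λ g y → g [ xs ]⇓ y) gs ys → DecidesAt f ys P → DecidesAt (compᶠ f gs) xs P
decidesAt-comp gs⇓ (inj₁ (p , f⇓))  = inj₁ (p , ⇓comp gs⇓ f⇓)
decidesAt-comp gs⇓ (inj₂ (¬p , f⇓)) = inj₂ (¬p , ⇓comp gs⇓ f⇓)

notᶠ : ∀ {n} → PartRec n → PartRec n
notᶠ f = compᶠ (precᶠ oneᶠ zeroᶠ) (f Vec.∷ Vec.[])

decidesAt-¬ : ∀ {n f P} {xs : Vec ℕ n} → DecidesAt f xs P → DecidesAt (notᶠ f) xs (¬ P)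
decidesAt-¬ (inj₁ (p , f⇓))  = inj₂ ((λ ¬p → ¬p p) , ⇓comp (f⇓ ∷ []) (⇓prec-suc (⇓prec-zero ⇓one) ⇓zero))
decidesAt-¬ (inj₂ (¬p , f⇓)) = inj₁ (¬p , ⇓comp (f⇓ ∷ []) (⇓prec-zero ⇓one))

-- Recursion on the first truth value acts as a case distinction: at 0 the result is 0, at 1 it is
-- the second truth value, which stands behind the counter and the previous value.
andᶠ : ∀ {n} → PartRec n → PartRec n → PartRec n
andᶠ f g = compᶠ (precᶠ zeroᶠ (projᶠ (suc (suc zero)))) (f Vec.∷ g Vec.∷ Vec.[])

decidesAt-× : ∀ {n f g P Q} {xs : Vec ℕ n} →
  DecidesAt f xs P → DecidesAt g xs Q → DecidesAt (andᶠ f g) xs (P × Q)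
decidesAt-× (inj₁ (p , f⇓))  (inj₁ (q , g⇓))  = inj₁ ((p , q) , ⇓comp (f⇓ ∷ g⇓ ∷ []) (⇓prec-suc (⇓prec-zero ⇓zero) ⇓proj))
decidesAt-× (inj₁ (p , f⇓))  (inj₂ (¬q , g⇓)) = inj₂ (¬q ∘ proj₂ , ⇓comp (f⇓ ∷ g⇓ ∷ []) (⇓prec-suc (⇓prec-zero ⇓zero) ⇓proj))
decidesAt-× (inj₂ (¬p , f⇓)) (inj₁ (_ , g⇓))  = inj₂ (¬p ∘ proj₁ , ⇓comp (f⇓ ∷ g⇓ ∷ []) (⇓prec-zero ⇓zero))
decidesAt-× (inj₂ (¬p , f⇓)) (inj₂ (_ , g⇓))  = inj₂ (¬p ∘ proj₁ , ⇓comp (f⇓ ∷ g⇓ ∷ []) (⇓prec-zero ⇓zero))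

orᶠ : ∀ {n} → PartRec n → PartRec n → PartRec n
orᶠ f g = notᶠ (andᶠ (notᶠ f) (notᶠ g))

decidesAt-⊎ : ∀ {n f g P Q} {xs : Vec ℕ n} →
  DecidesAt f xs P → DecidesAt g xs Q → DecidesAt (orᶠ f g) xs (P ⊎ Q)
decidesAt-⊎ {P = P} {Q} f-dec g-dec =
  decidesAt-⇔ to [ (λ p (¬p , _) → ¬p p) , (λ q (_ , ¬q) → ¬q q) ]′
    (decidesAt-¬ (decidesAt-× (decidesAt-¬ f-dec) (decidesAt-¬ g-dec)))
  where
  to : ¬ (¬ P × ¬ Q) → P ⊎ Q
  to ¬¬p×¬¬q with decidesAt⇒dec f-dec | decidesAt⇒dec g-dec
  ... | yes p | _     = inj₁ p
  ... | no _  | yes q = inj₂ q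
  ... | no ¬p | no ¬q = contradiction (¬p , ¬q) ¬¬p×¬¬q

-- The accumulator is itself a truth value, so `projᶠ (suc zero)` decides the search below `t`. The
-- other disjunct skips it and hands `f` the counter and the parameter.
anyᶠ : PartRec 2 → PartRec 2
anyᶠ f = precᶠ zeroᶠ (orᶠ (projᶠ (suc zero)) (compᶠ f (projᶠ zero Vec.∷ projᶠ (suc (suc zero)) Vec.∷ Vec.[])))

decidesAt-any : ∀ {f x} {P : ℕ → Set} → (∀ u → DecidesAt f (u Vec.∷ x Vec.∷ Vec.[]) (P u)) →
  ∀ t → DecidesAt (anyᶠ f) (t Vec.∷ x Vec.∷ Vec.[]) (∃[ u ] u < t × P u)
decidesAt-any f-dec zero = inj₂ ((λ ()) , ⇓prec-zero ⇓zero)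
decidesAt-any {f} {x} {P} f-dec (suc t) = decidesAt-⇔ to from step
  where
  to : (∃[ u ] u < t × P u) ⊎ P t → ∃[ u ] u < suc t × P u
  to (inj₁ (u , u<t , p)) = u , m<n⇒m<1+n u<t , p
  to (inj₂ p)             = t , ≤-refl , p

  from : ∃[ u ] u < suc t × P u → (∃[ u ] u < t × P u) ⊎ P t
  from (u , u<1+t , p) with m<1+n⇒m<n∨m≡n u<1+t
  ... | inj₁ u<t  = inj₁ (u , u<t , p)
  ... | inj₂ refl = inj₂ p

  last : ∀ {y} →
    DecidesAt (compᶠ f (projᶠ zero Vec.∷ projᶠ (suc (suc zero)) Vec.∷ Vec.[])) (t Vec.∷ y Vec.∷ x Vec.∷ Vec.[]) (P t)
  last = decidesAt-comp (⇓proj ∷ ⇓proj ∷ []) (f-dec t)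

  prec-suc : ∀ {n g h y Q} {xs : Vec ℕ n} → precᶠ g h [ t Vec.∷ xs ]⇓ y →
    DecidesAt h (t Vec.∷ y Vec.∷ xs) Q → DecidesAt (precᶠ g h) (suc t Vec.∷ xs) Q
  prec-suc g⇓ (inj₁ (q , h⇓))  = inj₁ (q , ⇓prec-suc g⇓ h⇓)
  prec-suc g⇓ (inj₂ (¬q , h⇓)) = inj₂ (¬q , ⇓prec-suc g⇓ h⇓)

  step : DecidesAt (anyᶠ f) (suc t Vec.∷ x Vec.∷ Vec.[]) ((∃[ u ] u < t × P u) ⊎ P t)
  step with decidesAt-any {f} {x} {P} f-dec t
  ... | inj₁ (p , f⇓)  = prec-suc f⇓ (decidesAt-⊎ (inj₁ (p , ⇓proj)) last)
  ... | inj₂ (¬p , f⇓) = prec-suc f⇓ (decidesAt-⊎ (inj₂ (¬p , ⇓proj)) last)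

-- The sieve, on codes of words

module Sieve {A C : ℕ → Set} {E : ℕ → ℕ → Set} {fA fC fE}
  (A-dec : ∀ x → DecidesAt fA (x Vec.∷ Vec.[]) (A x))
  (C-dec : ∀ x → DecidesAt fC (x Vec.∷ Vec.[]) (C x))
  (E-dec : ∀ j x → DecidesAt fE (j Vec.∷ x Vec.∷ Vec.[]) (E j x)) where

  -- A bounded, hence decidable, substitute for the question whether `E j` meets `C`. It is monotone
  -- in `x`: once a common element has been passed, `E j` never blocks again.
  Killed : ℕ → ℕ → Set
  Killed j x = ∃[ u ] u < x × C u × E j u

  Blocks : ℕ → ℕ → Set
  Blocks j x = E j x × ¬ Killed j x

  Blocked : ℕ → ℕ → Set
  Blocked s x = ∃[ j ] j < s × Blocks j x

  Admissible : ℕ → ℕ → Set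
  Admissible s x = A x × ¬ Blocked s x

  -- `anyᶠ` searches over the first argument and keeps the second as a parameter. Hence `meetsᶠ`
  -- takes the witness before the index, and `blocksᶠ` swaps its arguments: `x` becomes the search
  -- bound.
  meetsᶠ blocksᶠ admissibleᶠ : PartRec 2
  meetsᶠ      = andᶠ (compᶠ fC (projᶠ zero Vec.∷ Vec.[])) (compᶠ fE (projᶠ (suc zero) Vec.∷ projᶠ zero Vec.∷ Vec.[]))
  blocksᶠ     = andᶠ fE (notᶠ (compᶠ (anyᶠ meetsᶠ) (projᶠ (suc zero) Vec.∷ projᶠ zero Vec.∷ Vec.[])))
  admissibleᶠ = andᶠ (compᶠ fA (projᶠ (suc zero) Vec.∷ Vec.[])) (notᶠ (anyᶠ blocksᶠ))

  meets-dec : ∀ u j → DecidesAt meetsᶠ (u Vec.∷ j Vec.∷ Vec.[]) (C u × E j u)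
  meets-dec u j = decidesAt-× (decidesAt-comp (⇓proj ∷ []) (C-dec u)) (decidesAt-comp (⇓proj ∷ ⇓proj ∷ []) (E-dec j u))

  blocks-dec : ∀ j x → DecidesAt blocksᶠ (j Vec.∷ x Vec.∷ Vec.[]) (Blocks j x)
  blocks-dec j x = decidesAt-× (E-dec j x)
    (decidesAt-¬ (decidesAt-comp (⇓proj ∷ ⇓proj ∷ []) (decidesAt-any (λ u → meets-dec u j) x)))

  blocked-dec : ∀ s x → DecidesAt (anyᶠ blocksᶠ) (s Vec.∷ x Vec.∷ Vec.[]) (Blocked s x)
  blocked-dec s x = decidesAt-any (λ j → blocks-dec j x) s

  admissible-dec : ∀ s x → DecidesAt admissibleᶠ (s Vec.∷ x Vec.∷ Vec.[]) (Admissible s x)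
  admissible-dec s x = decidesAt-× (decidesAt-comp (⇓proj ∷ []) (A-dec x)) (decidesAt-¬ (blocked-dec s x))

  admissible? : ∀ s x → Dec (Admissible s x)
  admissible? s x = decidesAt⇒dec (admissible-dec s x)

  -- count x is the number of elements of B below x.
  count : ℕ → ℕ
  count zero    = 0
  count (suc x) = if does (admissible? (count x) x) then suc (count x) else count x

  B : ℕ → Set
  B x = Admissible (count x) x

  B⇒A : ∀ {x} → B x → A x
  B⇒A = proj₁

  addᶠ : PartRec 2
  addᶠ = precᶠ (projᶠ zero) (compᶠ sucᶠ (projᶠ (suc zero) Vec.∷ Vec.[]))

  -- The conditional in `count` becomes the addition of a truth value to the accumulator, which also
  -- serves as the stage at which admissibility is tested.
  countᶠ : PartRec 1
  countᶠ = precᶠ zeroᶠ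
    (compᶠ addᶠ (compᶠ admissibleᶠ (projᶠ (suc zero) Vec.∷ projᶠ zero Vec.∷ Vec.[]) Vec.∷ projᶠ (suc zero) Vec.∷ Vec.[]))

  ⇓count : ∀ x → countᶠ [ x Vec.∷ Vec.[] ]⇓ count x
  ⇓count zero = ⇓prec-zero ⇓zero
  -- Since `admissible?` is read off from `admissible-dec`, this split also reduces the conditional
  -- in `count (suc x)`.
  ⇓count (suc x) with admissible-dec (count x) x
  ... | inj₁ (_ , f⇓) = ⇓prec-suc (⇓count x)
    (⇓comp (⇓comp (⇓proj ∷ ⇓proj ∷ []) f⇓ ∷ ⇓proj ∷ [])
      (⇓prec-suc (⇓prec-zero ⇓proj) (⇓comp (⇓proj ∷ []) ⇓suc)))
  ... | inj₂ (_ , f⇓) = ⇓prec-suc (⇓count x)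
    (⇓comp (⇓comp (⇓proj ∷ ⇓proj ∷ []) f⇓ ∷ ⇓proj ∷ []) (⇓prec-zero ⇓proj))

  B-dec : ∀ x → DecidesAt (compᶠ admissibleᶠ (countᶠ Vec.∷ projᶠ zero Vec.∷ Vec.[])) (x Vec.∷ Vec.[]) (B x)
  B-dec x = decidesAt-comp (⇓count x ∷ ⇓proj ∷ []) (admissible-dec (count x) x)

  count-∈ : ∀ {x} → B x → count (suc x) ≡ suc (count x)
  count-∈ {x} b rewrite dec-true (admissible? (count x) x) b = refl

  count-∉ : ∀ {x} → ¬ B x → count (suc x) ≡ count x
  count-∉ {x} ¬b rewrite dec-false (admissible? (count x) x) ¬b = refl

  count-step : ∀ x → count x ≤ count (suc x)
  count-step x with admissible? (count x) x
  ... | yes _ = n≤1+n _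
  ... | no  _ = ≤-refl

  count-mono : ∀ {x y} → x ≤ y → count x ≤ count y
  count-mono {y = zero}  z≤n = ≤-refl
  count-mono {y = suc y} x≤1+y with m≤n⇒m<n∨m≡n x≤1+y
  ... | inj₁ (s≤s x≤y) = ≤-trans (count-mono x≤y) (count-step y)
  ... | inj₂ refl      = ≤-refl

  -- Accepting an element at count `s` raises the count for good. If such a `y` exists, `suc y` is a
  -- bound for `suc s`; otherwise the bound for `s` still works. Which case holds is not decided,
  -- hence the double negation.
  count-<⇒¬¬bounded : ∀ s → ¬ ¬ (∃[ N ] ∀ {x} → B x → count x < s → x < N)
  count-<⇒¬¬bounded zero    k = k (0 , λ _ ())
  count-<⇒¬¬bounded (suc s) k = ¬¬-excluded-middle {A = ∃[ y ] B y × count y ≡ s} λ where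
    (yes (y , b , refl)) → k (suc y , λ {x} _ c<1+s → ≰⇒> λ y<x →
      <⇒≱ c<1+s (≤-trans (≤-reflexive (sym (count-∈ b))) (count-mono y<x)))
    (no none) → count-<⇒¬¬bounded s λ (N , bound) → k (N , λ {x} b c<1+s →
      [ bound b , (λ c≡s → contradiction (x , b , c≡s) none) ]′ (m<1+n⇒m<n∨m≡n c<1+s))

  -- Such an `E j` is never killed, so it blocks all its elements once the count exceeds `j`. Those
  -- in `B` were therefore accepted at a count of at most `j`.
  disjoint⇒¬¬bounded : ∀ j → (∀ u → C u → ¬ E j u) → ¬ ¬ (∃[ N ] ∀ {x} → B x → E j x → x < N)
  disjoint⇒¬¬bounded j C⊥Ej k = count-<⇒¬¬bounded (suc j) λ (N , bound) → k (N , λ {x} b e →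
    bound b (s≤s (≮⇒≥ λ j<c →
      proj₂ b (j , j<c , e , λ (u , _ , c , e′) → C⊥Ej u c e′))))

  count-const : ∀ {N} → (∀ {x} → B x → x < N) → ∀ {x} → N ≤ x → count x ≡ count N
  count-const {zero}  bound {zero}  z≤n = refl
  count-const {N} bound {suc x} N≤1+x with m≤n⇒m<n∨m≡n N≤1+x
  ... | inj₁ (s≤s N≤x) = trans (count-∉ λ b → <⇒≱ (bound b) N≤x) (count-const bound N≤x)
  ... | inj₂ refl      = refl

  -- From `N` on nothing is accepted and the count is frozen, so an element of `A` can fail
  -- admissibility only by being blocked. Decidability of `Blocked` removes the double negation.
  bounded⇒blocked : ∀ {N} → (∀ {x} → B x → x < N) → ∀ {x} → N ≤ x → A x → Blocked (count N) x
  bounded⇒blocked {N} bound {x} N≤x a =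
    subst (λ s → Blocked s x) (count-const bound N≤x)
      (decidable-stable (decidesAt⇒dec (blocked-dec (count x) x)) λ ¬blocked →
        <⇒≱ (bound (a , ¬blocked)) N≤x)

-- `Finite` asks for an exact list, but `P` need not be decidable. Only finitely many instances of
-- excluded middle occur, so their double negations can be combined.
subset-of-list : ∀ {a} {X : Set a} (P : X → Set) (us : List X) →
  ¬ ¬ (∃[ ws ] (∀ {w} → P w → w ∈ˡ us → w ∈ˡ ws) × (∀ {w} → w ∈ˡ ws → P w))
subset-of-list P []       k = k ([] , (λ _ ()) , λ ())
subset-of-list P (u ∷ us) k = subset-of-list P us λ (ws , to , from) → ¬¬-excluded-middle λ where
  (yes p) → k (u ∷ ws
    , (λ { _ (here refl) → here refl ; q (there w∈us) → there (to q w∈us) })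
    , λ { (here refl) → p ; (there w∈ws) → from w∈ws })
  (no ¬p) → k (ws , (λ { p (here refl) → contradiction p ¬p ; q (there w∈us) → to q w∈us }) , from)

-- Bijectivity of the coding of words; finiteness as boundedness of codes.

module _ {X : Set} {n : ℕ} (enum : X ↔ Fin (suc n)) where

  open Inverse enum using (to; from; strictlyInverseˡ; strictlyInverseʳ)

  -- For a code `suc m`, the remainder of `m` modulo `suc n` gives the first letter, and the
  -- quotient, being at most `m`, is the code of the tail.
  code-surjective : ∀ m → ∃[ w ] code enum w ≡ m
  code-surjective = <-rec _ go
    where
    go : ∀ m → (∀ {q} → q < m → ∃[ w ] code enum w ≡ q) → ∃[ w ] code enum w ≡ m
    go zero    rec = [] , refl
    go (suc m) rec = from r ∷ w , cong suc (begin
      toℕ (to (from r)) + suc n * code enum w ≡⟨ cong₂ _+_ digit (cong (suc n *_) w≡) ⟩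
      m % suc n + suc n * (m / suc n)         ≡⟨ cong (m % suc n +_) (*-comm (suc n) _) ⟩
      m % suc n + m / suc n * suc n           ≡⟨ m≡m%n+[m/n]*n m (suc n) ⟨
      m                                       ∎)
      where
      open ≡-Reasoning
      r = fromℕ< (m%n<n m (suc n))
      w = proj₁ (rec (s≤s (m/n≤m m (suc n))))
      w≡ = proj₂ (rec (s≤s (m/n≤m m (suc n))))
      digit : toℕ (to (from r)) ≡ m % suc n
      digit = trans (cong toℕ (strictlyInverseˡ r)) (toℕ-fromℕ< _)

  code-injective : ∀ w v → code enum w ≡ code enum v → w ≡ v
  code-injective []      []      _  = refl
  code-injective (a ∷ w) (b ∷ v) eq = cong₂ _∷_ a≡b (code-injective w v tails)
    where
    open ≡-Reasoning
    eq′ : toℕ (to a) + suc n * code enum w ≡ toℕ (to b) + suc n * code enum v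
    eq′ = suc-injective eq
    rem : ∀ (i : Fin (suc n)) q → (toℕ i + suc n * q) % suc n ≡ toℕ i
    rem i q = begin
      (toℕ i + suc n * q) % suc n ≡⟨ cong (λ p → (toℕ i + p) % suc n) (*-comm (suc n) q) ⟩
      (toℕ i + q * suc n) % suc n ≡⟨ [m+kn]%n≡m%n (toℕ i) q (suc n) ⟩
      toℕ i % suc n               ≡⟨ m<n⇒m%n≡m (toℕ<n i) ⟩
      toℕ i                       ∎
    digits : toℕ (to a) ≡ toℕ (to b)
    digits = trans (sym (rem (to a) _)) (trans (cong (_% suc n) eq′) (rem (to b) _))
    tails : code enum w ≡ code enum v
    tails = *-cancelˡ-≡ _ _ (suc n) (+-cancelˡ-≡ (toℕ (to b)) _ _
      (trans (cong (_+ suc n * code enum w) (sym digits)) eq′))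
    a≡b : a ≡ b
    a≡b = trans (sym (strictlyInverseʳ a)) (trans (cong from (toℕ-injective digits)) (strictlyInverseʳ b))

  decode : ℕ → Word X
  decode m = proj₁ (code-surjective m)

  code-decode : ∀ m → code enum (decode m) ≡ m
  code-decode m = proj₂ (code-surjective m)

  decode-code : ∀ w → decode (code enum w) ≡ w
  decode-code w = code-injective _ _ (code-decode (code enum w))

  words-below : ℕ → List (Word X)
  words-below N = map decode (upTo N)

  ∈-words-below⁺ : ∀ {N w} → code enum w < N → w ∈ˡ words-below N
  ∈-words-below⁺ {N} {w} lt = subst (_∈ˡ words-below N) (decode-code w) (∈-map⁺ decode (∈-upTo⁺ lt))

  finite⇒bounded : ∀ {P : Language X} → Finite P → ∃[ N ] ∀ w → w ∈ P → code enum w < N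
  finite⇒bounded (ws , P⊆ws , _) = map₂ (λ bound w p → bound (P⊆ws p)) (go ws)
    where
    go : ∀ ws → ∃[ N ] ∀ {w} → w ∈ˡ ws → code enum w < N
    go []       = 0 , λ ()
    go (u ∷ us) with go us
    ... | N , bound = suc (code enum u) ⊔ N , λ where
      (here refl)  → m≤m⊔n _ N
      (there w∈us) → ≤-trans (bound w∈us) (m≤n⊔m _ N)

  bounded⇒¬¬finite : ∀ {P : Language X} {N} → (∀ w → w ∈ P → code enum w < N) → ¬ ¬ Finite P
  bounded⇒¬¬finite {P} {N} bound ¬fin = subset-of-list P (words-below N) λ (ws , P⇒ws , ws⇒P) →
    ¬fin (ws , (λ {w} p → P⇒ws p (∈-words-below⁺ (bound w p))) , ws⇒P)

  -- The sieve applied to one language: separation from `C` and infinitude.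

  module Core {ℓ : Level} (𝓛 : Pred (Language X) ℓ) (nontrivial : Nontrivial 𝓛) (wp : WPRecursive enum 𝓛)
    (∪-closed : ClosedUnderUnion 𝓛) (∁-closed : ClosedUnderComplement 𝓛)
    (C : Language X) (C-rec : Recursive enum C) where

    open Nontrivial nontrivial
    e      = proj₁ wp
    e∈𝓛    = proj₁ (proj₂ wp)
    e-surj = proj₁ (proj₂ (proj₂ wp))
    e-dec  = proj₂ (proj₂ (proj₂ (proj₂ wp)))

    -- Needed to show constructively that `Q` and `∁ Q` cover all words; an index of `Q` in the
    -- enumeration supplies the decision.
    member? : ∀ {Q} → Q ∈ 𝓛 → ∀ w → Dec (w ∈ Q)
    member? Q∈𝓛 w with e-surj _ Q∈𝓛
    ... | i , ei⊆Q , Q⊆ei with decidesAt⇒dec (e-dec i w)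
    ...   | yes w∈ei = yes (ei⊆Q w∈ei)
    ...   | no  w∉ei = no (w∉ei ∘ Q⊆ei)

    separated⇒cclass : ∀ {A Q : Language X} → Infinite A → Q ∈ 𝓛 → A ⊆ Q → C ⊥ Q → ⟨ A ⟩ ∈ cclass 1 C 𝓛
    separated⇒cclass {A} {Q} A-inf Q∈𝓛 A⊆Q C⊥Q = record
      { problem  = record
        { length≥1 = s≤s z≤n
        ; disjoint = λ { zero zero i≢j → contradiction refl i≢j }
        ; infinite = λ { zero → A-inf } }
      ; disjoint = λ { zero (c , a) → C⊥Q (c , A⊆Q a) } }
      , ∁ Q VecF.∷ Q VecF.∷ VecF.[]
      , record
        { members  = λ { zero → ∁-closed Q∈𝓛 ; (suc zero) → Q∈𝓛 }
        ; disjoint = λ where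
            zero       zero       i≢j → contradiction refl i≢j
            zero       (suc zero) _ (¬q , q) → ¬q q
            (suc zero) zero       _ (q , ¬q) → ¬q q
            (suc zero) (suc zero) i≢j → contradiction refl i≢j
        ; covers   = λ w → cover w (member? Q∈𝓛 w) }
      , (λ c q → C⊥Q (c , q))
      , s≤s z≤n , s≤s z≤n , id , id , λ { zero → A⊆Q }
      where
      cover : ∀ w → Dec (w ∈ Q) → ∃[ i ] w ∈ (∁ Q VecF.∷ Q VecF.∷ VecF.[]) i
      cover w (yes q) = suc zero , q
      cover w (no ¬q) = zero , ¬q

    -- The programs are specified on codes of words only; since every number is a code, they meet
    -- the demand of the sieve on all of ℕ.
    at-code : ∀ {f} {P : Language X} → (∀ w → DecidesAt f (code enum w Vec.∷ Vec.[]) (w ∈ P)) →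
      ∀ x → DecidesAt f (x Vec.∷ Vec.[]) (decode x ∈ P)
    at-code {f} {P} dec x = subst (λ y → DecidesAt f (y Vec.∷ Vec.[]) (decode x ∈ P)) (code-decode x) (dec (decode x))

    e-at-code : ∀ j x → DecidesAt (proj₁ (proj₂ (proj₂ (proj₂ wp)))) (j Vec.∷ x Vec.∷ Vec.[]) (decode x ∈ e j)
    e-at-code j x = subst (λ y → DecidesAt _ (j Vec.∷ y Vec.∷ Vec.[]) (decode x ∈ e j)) (code-decode x) (e-dec j (decode x))

    module _ (A : Language X) (A-rec : Recursive enum A) where

      open Sieve (at-code (proj₂ A-rec)) (at-code (proj₂ C-rec)) e-at-code

      coreSet : Language X
      coreSet w = B (code enum w)

      coreSet-rec : Recursive enum coreSet
      coreSet-rec = _ , λ w → B-dec (code enum w)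

      coreSet⊆A : coreSet ⊆ A
      coreSet⊆A {w} b = subst (_∈ A) (decode-code w) (B⇒A b)

      coreSet∩Q-¬¬bounded : ∀ {Q} → Q ∈ 𝓛 → C ⊥ Q →
        ¬ ¬ (∃[ N ] ∀ w → w ∈ coreSet → w ∈ Q → code enum w < N)
      coreSet∩Q-¬¬bounded Q∈𝓛 C⊥Q k with e-surj _ Q∈𝓛
      ... | j , ej⊆Q , Q⊆ej = disjoint⇒¬¬bounded j (λ _ c q → C⊥Q (c , ej⊆Q q)) λ (N , bound) →
        k (N , λ w b q → bound b (subst (_∈ e j) (sym (decode-code w)) (Q⊆ej q)))

      coreSet∩Q-finite : ∀ {P Q : Language X} → Q ∈ 𝓛 → C ⊥ Q → P ⊆ coreSet → P ⊆ Q → ¬ Infinite P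
      coreSet∩Q-finite Q∈𝓛 C⊥Q P⊆B P⊆Q P-inf = coreSet∩Q-¬¬bounded Q∈𝓛 C⊥Q λ (N , bound) →
        bounded⇒¬¬finite (λ w p → bound w (P⊆B p) (P⊆Q p)) P-inf

      -- `Q` is the union of those `e j` with `j < s` that are disjoint from `C`. Every other one is
      -- killed eventually, and `M` lies beyond the points where this happens. Disjointness from `C`
      -- is not decided, so the result is doubly negated.
      blocker : ∀ s → ¬ ¬ (Σ[ Q ∈ Language X ] Q ∈ 𝓛 × C ⊥ Q ×
        (∃[ M ] ∀ {x} → M ≤ x → Blocked s x → decode x ∈ Q))
      blocker zero    k = k (_ , ∅∈ , proj₂ , 0 , λ { _ (_ , () , _) })
      blocker (suc s) k = blocker s λ (Q , Q∈𝓛 , C⊥Q , M , covers) →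
        ¬¬-excluded-middle {A = ∃[ u ] decode u ∈ C × decode u ∈ e s} λ where
        -- Beyond the common element `u`, `e s` is killed and blocks nothing, so `Q` stays as it is
        -- and only the threshold moves.
        (yes (u , c , eu)) → k (Q , Q∈𝓛 , C⊥Q , suc u ⊔ M , λ where
          M′≤x (j , j<1+s , ej , ¬killed) → [
              (λ j<s → covers (m⊔n≤o⇒n≤o (suc u) M M′≤x) (j , j<s , ej , ¬killed)) ,
              (λ { refl → contradiction (u , m⊔n≤o⇒m≤o (suc u) M M′≤x , c , eu) ¬killed })
            ]′ (m<1+n⇒m<n∨m≡n j<1+s))
        (no C∩es≡∅) → k (Q ∪ e s , ∪-closed Q∈𝓛 (e∈𝓛 s)
          , (λ where
              (c , inj₁ q)      → C⊥Q (c , q)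
              {w} (c , inj₂ es) → C∩es≡∅ (code enum w ,
                subst (_∈ C) (sym (decode-code w)) c , subst (_∈ e s) (sym (decode-code w)) es))
          , M , λ where
              M≤x (j , j<1+s , ej , ¬killed) → [
                  (λ j<s → inj₁ (covers M≤x (j , j<s , ej , ¬killed))) ,
                  (λ { refl → inj₂ ej })
                ]′ (m<1+n⇒m<n∨m≡n j<1+s))

      -- The goal is a contradiction, so the doubly negated `blocker` can be used at the final stage
      -- `count N`.
      coreSet-infinite : C ⊥ A → Infinite A → ⟨ A ⟩ ∉ cclass 1 C 𝓛 → Infinite coreSet
      coreSet-infinite C⊥A A-inf A∉cclass fin with finite⇒bounded fin
      ... | N , bound = blocker (count N) λ (Q , Q∈𝓛 , C⊥Q , M , covers) →
        -- From `M ⊔ N` on, every word of `A` is blocked and hence lies in `Q`. The finitely many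
        -- earlier words are filtered by `A`, which keeps the enlarged set disjoint from `C`.
        A∉cclass (separated⇒cclass A-inf (∪fin Q∈𝓛 (initial (M ⊔ N) , id , id))
          (λ {w} a → [
              (λ lt → inj₂ (∈-filter⁺ A? (∈-words-below⁺ lt) a)) ,
              (λ ge → inj₁ (subst (_∈ Q) (decode-code w)
                (covers (m⊔n≤o⇒m≤o M N ge) (bounded⇒blocked B-bound (m⊔n≤o⇒n≤o M N ge)
                  (subst (_∈ A) (sym (decode-code w)) a)))))
            ]′ (<-≤-connex (code enum w) (M ⊔ N)))
          λ where
            (c , inj₁ q) → C⊥Q (c , q)
            (c , inj₂ i) → C⊥A (c , proj₂ (∈-filter⁻ A? {xs = words-below (M ⊔ N)} i)))
        where
        A? : ∀ w → Dec (w ∈ A)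
        A? w = decidesAt⇒dec (proj₂ A-rec w)

        initial : ℕ → List (Word X)
        initial K = filter A? (words-below K)

        B-bound : ∀ {x} → B x → x < N
        B-bound {x} b = subst (_< N) (code-decode x) (bound (decode x) (subst B (sym (code-decode x)) b))

theorem5p4 : ∀ {ℓ : Level} {X : Set} {n : ℕ} (enum : X ↔ Fin (suc n))
    (𝓛 : Pred (Language X) ℓ) → 𝓛 Respects _≐_ →
    Nontrivial 𝓛 → WPRecursive enum 𝓛 →
    ClosedUnderUnion 𝓛 → ClosedUnderIntersection 𝓛 → ClosedUnderComplement 𝓛 →
    ∀ {k : ℕ} (C : Language X) (A : Vector (Language X) k) → ConditionalProblem C A →
    Recursive enum C →
    (∀ i → Recursive enum (A i)) → (∀ i → ⟨ A i ⟩ ∉ cclass 1 C 𝓛) →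
    Σ[ B ∈ Vector (Language X) k ] B ≼ A × B ∈ ccore k C 𝓛 × (∀ i → Recursive enum (B i))
theorem5p4 {X = X} enum 𝓛 _ nontrivial wp ∪-closed _ ∁-closed {k} C A cond C-rec A-rec A∉cclass =
  B , (length≥1 , ≤-refl , id , id , λ i → B⊆A i) , (B-cond , B-core) , λ i → coreSet-rec (A i) (A-rec i)
  where
  open Core enum 𝓛 nontrivial wp ∪-closed ∁-closed C C-rec
  open ConditionalProblem cond renaming (disjoint to C⊥A)
  open ClassificationProblem problem

  B : Vector (Language X) k
  B i = coreSet (A i) (A-rec i)

  B⊆A : ∀ i → B i ⊆ A i
  B⊆A i = coreSet⊆A (A i) (A-rec i)

  B-cond : ConditionalProblem C B
  B-cond = record
    { problem  = record
      { length≥1 = length≥1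
      ; disjoint = λ i j i≢j (bi , bj) → disjoint i j i≢j (B⊆A i bi , B⊆A j bj)
      ; infinite = λ i → coreSet-infinite (A i) (A-rec i) (C⊥A i) (infinite i) (A∉cclass i) }
    ; disjoint = λ i (c , b) → C⊥A i (c , B⊆A i b) }

  B-core : ∀ {m} (A′ : Vector (Language X) m) → ClassificationProblem A′ → A′ ≼ B → A′ ∉ cclass m C 𝓛
  B-core {suc m} A′ A′-prob (_ , _ , σ , _ , A′⊆B) (_ , Q , Q-part , C⊆Q₀ , _ , _ , τ , _ , A′⊆Q) =
    -- One component suffices: `A′ zero` is an infinite part of `B (σ zero)` inside a partition
    -- class other than `Q zero`, and that class is disjoint from `C` because `C` lies in `Q zero`.
    coreSet∩Q-finite (A (σ zero)) (A-rec (σ zero))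
      (members (suc (τ zero)))
      (λ (c , q) → Q-disjoint zero (suc (τ zero)) (λ ()) (C⊆Q₀ c , q))
      (A′⊆B zero) (A′⊆Q zero)
      (ClassificationProblem.infinite A′-prob zero)
    where
    open IsPartition Q-part renaming (disjoint to Q-disjoint)
  B-core {zero} _ _ (() , _)
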